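{- Let $\mathcal{A}$ be a finite alphabet. An episturmian word $\mathbf{t}\in\mathcal{A}^\omega$ has a unique (spinned) directive word over $\mathcal{A}\cup\bar{\mathcal{A}}$ if and only if it has a normalized directive word that contains all of the following: 1) infinitely many $L$-spinned letters, 2) infinitely many $R$-spinned letters, 3) no factor in $\bigcup_{a\in\mathcal{A}}\bar{a}\,\bar{\mathcal{A}}^*a$, 4) no factor in $\bigcup_{a\in\mathcal{A}}a\,\mathcal{A}^*\bar{a}$. Such an episturmian word is necessarily aperiodic.
   Context: Words. $\mathcal{A}^*$ and $\mathcal{A}^\omega$ denote the sets of finite and of right-infinite words over the finite alphabet $\mathcal{A}$. A factor of a word is a finite block of consecutive letters of it. An infinite word is recurrent if each of its factors occurs infinitely often in it. It is aperiodic if it is not ultimately periodic, i.e. not of the form $uv^\omega=uvvv\cdots$ with $u,v$ finite words and $v$ non-empty. Episturmian words. A factor $u$ of an infinite word $\mathbf{w}$ is right special if $ua$ and $ub$ are factors of $\mathbf{w}$ for two distinct letters $a,b$. An infinite word $\mathbf{t}\in\mathcal{A}^\omega$ is episturmian if its set of factors is closed under reversal (mirror image) and $\mathbf{t}$ has at most one right special factor of each length. Spinned words. $\bar{\mathcal{A}}=\{\bar{x}\mid x\in\mathcal{A}\}$ is a disjoint copy of $\mathcal{A}$. Letters of $\mathcal{A}$ are called $L$-spinned, letters of $\bar{\mathcal{A}}$ are called $R$-spinned. A finite or infinite word over $\mathcal{A}\cup\bar{\mathcal{A}}$ is called a spinned word. $\bar{a}\,\bar{\mathcal{A}}^*a$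 is the set of words $\bar{a}\,u\,a$ with $u$ a (possibly empty) finite word over $\bar{\mathcal{A}}$, and $a\,\mathcal{A}^*\bar{a}$ is the set of words $a\,u\,\bar{a}$ with $u$ a (possibly empty) finite word over $\mathcal{A}$. Morphisms and directive words. For $a\in\mathcal{A}$, $L_a$ and $R_a$ are the morphisms of $\mathcal{A}^*$ (extended letterwise to infinite words) given by $L_a(a)=R_a(a)=a$ and, for $b\ne a$, $L_a(b)=ab$, $R_a(b)=ba$. Put $\mu_a=L_a$ and $\mu_{\bar{a}}=R_a$. A spinned infinite word $\Delta=\breve{x}_1\breve{x}_2\breve{x}_3\cdots$ (with $\breve{x}_n\in\mathcal{A}\cup\bar{\mathcal{A}}$) directs, or is a (spinned) directive word of, the episturmian word $\mathbf{t}$ if there is a sequence $(\mathbf{t}^{(n)})_{n\ge0}$ of recurrent infinite words over $\mathcal{A}$ with $\mathbf{t}^{(0)}=\mathbf{t}$ and $\mathbf{t}^{(n-1)}=\mu_{\breve{x}_n}(\mathbf{t}^{(n)})$ for all $n\ge1$. Normalized directive words. A directive word of an episturmian word is called normalized if it contains infinitely many $L$-spinned letters and no factor in $\bigcup_{a\in\mathcal{A}}\bar{a}\,\bar{\mathcal{A}}^*a$. Every episturmian word has a normalized directive word, and it is unique when the episturmian word is aperiodic. -}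

module Defs where

open import Data.Fin using (Fin; _≟_)
open import Data.List using (List; []; _∷_; [_]; _++_; _∷ʳ_; map; length; reverse; applyUpTo)
open import Data.List.NonEmpty using (List⁺; _∷_)
open import Data.Nat using (ℕ; zero; suc; _+_; _≤_)
open import Data.Product using (∃; ∃₂; _×_)
open import Function using (_∘_; const)
open import Relation.Binary.PropositionalEquality using (_≡_; _≢_; _≗_)
open import Relation.Nullary using (¬_; yes; no)

-- Infinite words are functions, compared with pointwise equality _≗_
-- throughout since function extensionality is not available.
ω-Word : Set → Set
ω-Word A = ℕ → A

module _ {A : Set} where

  OccursAt : List A → ω-Word A → ℕ → Set
  OccursAt u w i = applyUpTo (λ j → w (i + j)) (length u) ≡ u

  Factor : List A → ω-Word A → Set
  Factor u w = ∃ λ i → OccursAt u w i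

  InfinitelyOften : (A → Set) → ω-Word A → Set
  InfinitelyOften P w = ∀ N → ∃ λ n → N ≤ n × P (w n)

  Recurrent : ω-Word A → Set
  Recurrent w = ∀ u → Factor u w → ∀ N → ∃ λ i → N ≤ i × OccursAt u w i

  -- flatten v f is the infinite concatenation v · f 0 · f 1 · f 2 ⋯
  flatten : List⁺ A → (ℕ → List⁺ A) → ω-Word A
  flatten (x ∷ _)      f zero    = x
  flatten (_ ∷ [])     f (suc i) = flatten (f 0) (f ∘ suc) i
  flatten (_ ∷ y ∷ ys) f (suc i) = flatten (y ∷ ys) f i

  concatω : (ℕ → List⁺ A) → ω-Word A
  concatω f = flatten (f 0) (f ∘ suc)

  infix 8 _^ω
  _^ω : List⁺ A → ω-Word A
  v ^ω = concatω (const v)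

  infixr 5 _·_
  _·_ : List A → ω-Word A → ω-Word A
  ([]      · w) i       = w i
  ((x ∷ u) · w) zero    = x
  ((x ∷ u) · w) (suc i) = (u · w) i

  UltimatelyPeriodic : ω-Word A → Set
  UltimatelyPeriodic w = ∃₂ λ (u : List A) (v : List⁺ A) → w ≗ u · v ^ω

  Aperiodic : ω-Word A → Set
  Aperiodic w = ¬ UltimatelyPeriodic w

  RightSpecial : List A → ω-Word A → Set
  RightSpecial u w = Factor u w ×
    ∃₂ λ a b → a ≢ b × Factor (u ∷ʳ a) w × Factor (u ∷ʳ b) w

  ClosedUnderReversal : ω-Word A → Set
  ClosedUnderReversal w = ∀ u → Factor u w → Factor (reverse u) w

  Episturmian : ω-Word A → Set
  Episturmian t = ClosedUnderReversal t ×
    (∀ u v → length u ≡ length v → RightSpecial u t → RightSpecial v t → u ≡ v)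

-- The alphabet 𝒜 ∪ 𝒜̄: L a is the letter a, R a is the barred letter ā.
data Spinned (A : Set) : Set where
  L R : A → Spinned A

module _ {A : Set} where

  IsL IsR : Spinned A → Set
  IsL x = ∃ λ a → x ≡ L a
  IsR x = ∃ λ a → x ≡ R a

  -- No factor in ⋃ₐ ā 𝒜̄* a.
  NoR⋯L : ω-Word (Spinned A) → Set
  NoR⋯L Δ = ∀ a (u : List A) → ¬ Factor (R a ∷ map R u ++ [ L a ]) Δ

  -- No factor in ⋃ₐ a 𝒜* ā.
  NoL⋯R : ω-Word (Spinned A) → Set
  NoL⋯R Δ = ∀ a (u : List A) → ¬ Factor (L a ∷ map L u ++ [ R a ]) Δ

  Normalized : ω-Word (Spinned A) → Set
  Normalized Δ = InfinitelyOften IsL Δ × NoR⋯L Δ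

module _ {k : ℕ} where

  -- μ (L a) = L_a and μ (R a) = R_a, given by their values on letters.
  μ : Spinned (Fin k) → Fin k → List⁺ (Fin k)
  μ (L a) b with a ≟ b
  ... | yes _ = a ∷ []
  ... | no  _ = a ∷ b ∷ []
  μ (R a) b with a ≟ b
  ... | yes _ = a ∷ []
  ... | no  _ = b ∷ a ∷ []

  μω : Spinned (Fin k) → ω-Word (Fin k) → ω-Word (Fin k)
  μω x w = concatω (μ x ∘ w)

  -- Indexing starts at 0, so Δ n is the (n+1)-st letter of the directive word.
  Directs : ω-Word (Spinned (Fin k)) → ω-Word (Fin k) → Set
  Directs Δ t = ∃ λ (s : ℕ → ω-Word (Fin k)) →
    s 0 ≗ t × (∀ n → Recurrent (s n)) × (∀ n → s n ≗ μω (Δ n) (s (suc n)))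

{-# OPTIONS --safe #-}
module Submission where

-- Everything rests on L_a(w) = a · R_a(w), whence R_a(a · w) = L_a(w) and, for c ≠ a,
-- R_a(c · w) = c · L_a(w).
--
-- If Δ is unique, a letter R a cannot act on a word a · w, since the tail of a directed word
-- is again directed; and a letter L a cannot act on w when a · w is directed. The first rules
-- out factors ā 𝒜̄* a and a tail of R's, the second factors a 𝒜* ā and a tail of L's.
--
-- Conversely, under the four conditions desubstitution strictly shortens an eventual period,
-- so t is aperiodic; this determines the first letter of Δ up to its spin, because two distinct
-- separating letters would have to alternate. If both spins were possible, with t = L_a(w),
-- then a · w would be recurrent; this property survives desubstitution by L's and is
-- contradicted at the first R.

open import Algebra.Properties.CommutativeSemigroup using (x∙yz≈y∙xz)
open import Axiom.ExcludedMiddle using (ExcludedMiddle)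
open import Data.Empty using (⊥-elim)
open import Data.Fin using (Fin; zero; suc; _≟_)
open import Data.List using (List; []; _∷_; [_]; _++_; map; length; applyUpTo)
open import Data.List.NonEmpty using (List⁺; _∷_) renaming (length to length⁺)
open import Data.List.Properties using (length-applyUpTo; ∷-injectiveˡ; ∷-injectiveʳ)
open import Data.Nat using (ℕ; zero; suc; _+_; _*_; _∸_; _≤_; _<_; _⊔_; z≤n; s≤s)
open import Data.Nat.Properties hiding (_≟_)
open import Data.Product using (∃; ∃₂; ∃!; _×_; _,_; proj₁; proj₂)
open import Data.Sum using (_⊎_; inj₁; inj₂; fromInj₁; fromInj₂)
open import Function using (_∘_)
open import Function.Bundles using (_⇔_; mk⇔)
open import Level using (0ℓ)
open import Relation.Binary.PropositionalEquality hiding ([_])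
open import Relation.Nullary using (¬_; Dec; yes; no; contradiction)
open import Relation.Nullary.Decidable using (decidable-stable)
open import Defs

-- Prepending, shifting and comparing infinite words

infixr 5 _◃_

_◃_ : {A : Set} → A → ω-Word A → ω-Word A
(a ◃ w) zero    = a
(a ◃ w) (suc i) = w i

tail : {A : Set} → ω-Word A → ω-Word A
tail w = w ∘ suc

drop : {A : Set} → ℕ → ω-Word A → ω-Word A
drop n w i = w (n + i)

Agree : {A : Set} → ℕ → ω-Word A → ω-Word A → Set
Agree n v w = ∀ i → i < n → v i ≡ w i

Agree-tail : ∀ {A : Set} (v w : ω-Word A) {n} → Agree (suc n) v w → Agree n (tail v) (tail w)
Agree-tail v w h i i<n = h (suc i) (s≤s i<n)

+-exchange : ∀ m n o → m + (n + o) ≡ n + (m + o)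
+-exchange = x∙yz≈y∙xz +-commutativeSemigroup

drop-· : ∀ {A : Set} (u : List A) w → drop (length u) (u · w) ≗ w
drop-· []      w i = refl
drop-· (x ∷ u) w i = drop-· u w i

drop-flatten : ∀ {A : Set} x (xs : List A) f → drop (suc (length xs)) (flatten (x ∷ xs) f) ≗ concatω f
drop-flatten x []       f i = refl
drop-flatten x (y ∷ ys) f i = drop-flatten y ys f i

bounded : ∀ {n} (f : Fin n → ℕ) → ∃ λ M → ∀ i → f i ≤ M
bounded {zero}  f = 0 , λ ()
bounded {suc n} f = let M , f≤M = bounded (f ∘ suc) in f zero ⊔ M , λ where
  zero    → m≤m⊔n (f zero) M
  (suc i) → ≤-trans (f≤M i) (m≤n⊔m (f zero) M)

-- Recurrence

applyUpTo-agree : ∀ {A : Set} (v w : ω-Word A) n → applyUpTo v n ≡ applyUpTo w n → Agree n v w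
applyUpTo-agree v w (suc n) eq zero    _         = ∷-injectiveˡ eq
applyUpTo-agree v w (suc n) eq (suc i) (s≤s i<n) =
  applyUpTo-agree (tail v) (tail w) n (∷-injectiveʳ eq) i i<n

agree-applyUpTo : ∀ {A : Set} (v w : ω-Word A) n → Agree n v w → applyUpTo v n ≡ applyUpTo w n
agree-applyUpTo v w zero    h = refl
agree-applyUpTo v w (suc n) h =
  cong₂ _∷_ (h 0 (s≤s z≤n)) (agree-applyUpTo (tail v) (tail w) n (Agree-tail v w h))

PrefixRecurrent : {A : Set} → ω-Word A → Set
PrefixRecurrent w = ∀ l N → ∃ λ j → N ≤ j × Agree l (drop j w) w

prefixRecurrent : ∀ {A : Set} (w : ω-Word A) → Recurrent w → PrefixRecurrent w
prefixRecurrent w rec l N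
  with rec (applyUpTo w l) (0 , cong (applyUpTo w) (length-applyUpTo w l)) N
... | j , N≤j , occ = j , N≤j ,
  applyUpTo-agree (drop j w) w l
    (subst (λ n → applyUpTo (drop j w) n ≡ applyUpTo w l) (length-applyUpTo w l) occ)

-- A factor found at position `i` lies inside the prefix of length `i + length u`, so it returns
-- whenever that prefix does.
recurrent : ∀ {A : Set} (w : ω-Word A) → PrefixRecurrent w → Recurrent w
recurrent w rec u (i , occ) N with rec (i + length u) N
... | j , N≤j , agr = j + i , ≤-trans N≤j (m≤m+n j i) ,
  trans (agree-applyUpTo _ _ (length u) λ q q<l →
           trans (cong w (+-assoc j i q)) (agr (i + q) (+-monoʳ-< i q<l)))
        occ

Recurrent-resp : ∀ {A : Set} {v w : ω-Word A} → v ≗ w → Recurrent v → Recurrent w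
Recurrent-resp {v = v} {w} v≗w rec = recurrent w λ l N →
  let j , N≤j , agr = prefixRecurrent v rec l N
  in j , N≤j , λ i i<l → trans (sym (v≗w _)) (trans (agr i i<l) (v≗w i))

Recurrent-tail : ∀ {A : Set} (w : ω-Word A) → Recurrent w → Recurrent (tail w)
Recurrent-tail w rec = recurrent (tail w) λ l N →
  let j , N≤j , agr = prefixRecurrent w rec (suc l) N
  in j , N≤j , λ i i<l → trans (cong w (sym (+-suc j i))) (agr (suc i) (s≤s i<l))

-- LeftExtends c w means that c ◃ w is recurrent and has the same factors as w.
LeftExtends : {A : Set} → A → ω-Word A → Set
LeftExtends c w = ∀ l N → ∃ λ j → N ≤ j × w j ≡ c × Agree l (drop (suc j) w) w

LeftExtends-resp : ∀ {A : Set} {c : A} {v w} → v ≗ w → LeftExtends c v → LeftExtends c w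
LeftExtends-resp v≗w ext l N =
  let j , N≤j , eq , agr = ext l N
  in j , N≤j , trans (sym (v≗w j)) eq , λ i i<l → trans (sym (v≗w _)) (trans (agr i i<l) (v≗w i))

leftExtends-recurrent : ∀ {A : Set} (c : A) w → LeftExtends c w → Recurrent (c ◃ w)
leftExtends-recurrent c w ext = recurrent (c ◃ w) λ l N →
  let j , N≤j , eq , agr = ext l N
  in suc j , m≤n⇒m≤1+n N≤j , λ where
       zero    _     → trans (cong w (+-identityʳ j)) eq
       (suc i) si<l  → trans (cong w (+-suc j i)) (agr i (<-trans (n<1+n i) si<l))

recurrent-leftExtends : ∀ {A : Set} (w : ω-Word A) → Recurrent w → LeftExtends (w 0) (tail w)
-- Asking for `suc N` makes the return positive; it is position `j` of `tail w`, where the head of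
-- `w` reappears.
recurrent-leftExtends w rec l N with prefixRecurrent w rec (suc l) (suc N)
... | suc j , s≤s N≤j , agr =
  j , N≤j , trans (cong (w ∘ suc) (sym (+-identityʳ j))) (agr 0 (s≤s z≤n)) ,
  λ i i<l → trans (cong (w ∘ suc) (sym (+-suc j i))) (agr (suc i) (s≤s i<l))

-- The morphisms L_a and R_a

module _ {k : ℕ} where

  private
    Word : Set
    Word = ω-Word (Fin k)

  μL-zero : ∀ a (w : Word) → μω (L a) w 0 ≡ a
  μL-zero a w with a ≟ w 0
  ... | yes _ = refl
  ... | no _  = refl

  μL-hit : ∀ {a} (w : Word) → w 0 ≡ a → tail (μω (L a) w) ≗ μω (L a) (tail w)
  μL-hit {a} w eq i with a ≟ w 0
  ... | yes _ = refl
  ... | no ne = contradiction (sym eq) ne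

  μL-miss : ∀ {a} (w : Word) → w 0 ≢ a → tail (μω (L a) w) ≗ w 0 ◃ μω (L a) (tail w)
  μL-miss {a} w ne i with a ≟ w 0
  μL-miss w ne i       | yes eq = contradiction (sym eq) ne
  μL-miss w ne zero    | no _   = refl
  μL-miss w ne (suc i) | no _   = refl

  μR≗tail-μL : ∀ a (w : Word) → μω (R a) w ≗ tail (μω (L a) w)
  μR≗tail-μL a w zero with a ≟ w 0
  ... | yes eq = sym (μL-zero a (tail w))
  ... | no _   = refl
  μR≗tail-μL a w (suc i) with a ≟ w 0
  μR≗tail-μL a w (suc i)       | yes _ = μR≗tail-μL a (tail w) i
  μR≗tail-μL a w (suc zero)    | no _  = sym (μL-zero a (tail w))
  μR≗tail-μL a w (suc (suc i)) | no _  = μR≗tail-μL a (tail w) i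

  μR-hit : ∀ {a} (w : Word) → w 0 ≡ a → μω (R a) w ≗ μω (L a) (tail w)
  μR-hit w eq i = trans (μR≗tail-μL _ w i) (μL-hit w eq i)

  μR-miss : ∀ {a} (w : Word) → w 0 ≢ a → μω (R a) w ≗ w 0 ◃ μω (L a) (tail w)
  μR-miss w ne i = trans (μR≗tail-μL _ w i) (μL-miss w ne i)

  μR-zero : ∀ a (w : Word) → μω (R a) w 0 ≡ w 0
  μR-zero a w with w 0 ≟ a
  ... | yes eq = trans (μR-hit w eq 0) (trans (μL-zero a (tail w)) (sym eq))
  ... | no ne  = μR-miss w ne 0

  μL≗◃μR : ∀ a (w : Word) → μω (L a) w ≗ a ◃ μω (R a) w
  μL≗◃μR a w zero    = μL-zero a w
  μL≗◃μR a w (suc i) = sym (μR≗tail-μL a w i)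

  -- Every block starts with `a`, so the letter at position 1 reveals the first block: it is `a` if
  -- that block is `a` alone, and otherwise it is the encoded letter. Blocks have at most two
  -- letters, whence the factor 2.
  μL-decode : ∀ {a} l (v w : Word) → Agree (suc (l * 2)) (μω (L a) v) (μω (L a) w) → Agree l v w
  μL-decode {a} (suc l) v w h = go (v 0 ≟ a) (w 0 ≟ a)
    where
    h₁ : tail (μω (L a) v) 0 ≡ tail (μω (L a) w) 0
    h₁ = h 1 (s≤s (s≤s z≤n))

    go : Dec (v 0 ≡ a) → Dec (w 0 ≡ a) → Agree (suc l) v w
    go (yes p) (yes q) zero    _         = trans p (sym q)
    go (yes p) (yes q) (suc i) (s≤s i<l) = μL-decode l (tail v) (tail w)
      (λ j j< → trans (sym (μL-hit v p j))
                  (trans (h (suc j) (s≤s (m≤n⇒m≤1+n j<))) (μL-hit w q j))) i i<l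
    go (no p) (no q) zero    _         =
      trans (sym (μL-miss v p 0)) (trans h₁ (μL-miss w q 0))
    go (no p) (no q) (suc i) (s≤s i<l) = μL-decode l (tail v) (tail w)
      (λ j j< → trans (sym (μL-miss v p (suc j)))
                  (trans (h (suc (suc j)) (s≤s (s≤s j<))) (μL-miss w q (suc j)))) i i<l
    go (yes p) (no q) = contradiction
      (trans (sym (trans h₁ (μL-miss w q 0))) (trans (μL-hit v p 0) (μL-zero a (tail v)))) q
    go (no p) (yes q) = contradiction
      (trans (sym (μL-miss v p 0)) (trans h₁ (trans (μL-hit w q 0) (μL-zero a (tail w))))) p

  -- The letter gained is the `a` that opens the next block, whatever that block is.
  μL-encode : ∀ {a} l (v w : Word) → Agree l v w → Agree (suc l) (μω (L a) v) (μω (L a) w)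
  μL-encode {a} l       v w h zero    _         = trans (μL-zero a v) (sym (μL-zero a w))
  μL-encode {a} (suc l) v w h (suc i) (s≤s i<l) = go (v 0 ≟ a) i i<l
    where
    h₀ : v 0 ≡ w 0
    h₀ = h 0 (s≤s z≤n)

    rest : Agree (suc l) (μω (L a) (tail v)) (μω (L a) (tail w))
    rest = μL-encode l (tail v) (tail w) (Agree-tail v w h)

    go : Dec (v 0 ≡ a) → Agree (suc l) (tail (μω (L a) v)) (tail (μω (L a) w))
    go (yes p) i i<l = trans (μL-hit v p i)
      (trans (rest i i<l) (sym (μL-hit w (trans (sym h₀) p) i)))
    go (no p) zero i<l = trans (μL-miss v p 0)
      (trans h₀ (sym (μL-miss w (p ∘ trans h₀) 0)))
    go (no p) (suc i) i<l = trans (μL-miss v p (suc i))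
      (trans (rest i (<-trans (n<1+n i) i<l)) (sym (μL-miss w (p ∘ trans h₀) (suc i))))

  μL-injective : ∀ {a} {v w : Word} → μω (L a) v ≗ μω (L a) w → v ≗ w
  μL-injective {a} {v} {w} eq i = μL-decode {a} (suc i) v w (λ j _ → eq j) i (n<1+n i)

  μ-injective : ∀ x {v w : Word} → μω x v ≗ μω x w → v ≗ w
  μ-injective (L a) eq = μL-injective eq
  μ-injective (R a) {v} {w} eq = μL-injective {a} λ where
    zero    → trans (μL-zero a v) (sym (μL-zero a w))
    (suc i) → trans (sym (μR≗tail-μL a v i)) (trans (eq i) (μR≗tail-μL a w i))

  μL-cong : ∀ {a} {v w : Word} → v ≗ w → μω (L a) v ≗ μω (L a) w
  μL-cong {a} {v} {w} eq i = μL-encode {a} i v w (λ j _ → eq j) i (n<1+n i)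

  μ-cong : ∀ x {v w : Word} → v ≗ w → μω x v ≗ μω x w
  μ-cong (L a) eq = μL-cong eq
  μ-cong (R a) {v} {w} eq i =
    trans (μR≗tail-μL a v i) (trans (μL-cong {a} eq (suc i)) (sym (μR≗tail-μL a w i)))

  -- Cut a w n j says that the block of w j in L_a(w) ends at position n:
  -- the last letter of L_a(b) is always b.
  Cut : Fin k → Word → ℕ → ℕ → Set
  Cut a w n j = μω (L a) w n ≡ w j × drop (suc n) (μω (L a) w) ≗ μω (L a) (drop (suc j) w)

  Cut-hit : ∀ a w {n j} → w 0 ≡ a → Cut a (tail w) n j → Cut a w (suc n) (suc j)
  Cut-hit a w {n} eq (e , r) =
    trans (μL-hit w eq n) e , λ i → trans (μL-hit w eq _) (r i)

  Cut-miss : ∀ a w {n j} → w 0 ≢ a → Cut a (tail w) n j → Cut a w (suc (suc n)) (suc j)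
  Cut-miss a w {n} ne (e , r) =
    trans (μL-miss w ne (suc n)) e , λ i → trans (μL-miss w ne (suc (suc n + i))) (r i)

  Cut-hit₀ : ∀ a w → w 0 ≡ a → Cut a w 0 0
  Cut-hit₀ a w eq = trans (μL-zero a w) (sym eq) , μL-hit w eq

  Cut-miss₀ : ∀ a w → w 0 ≢ a → Cut a w 1 0
  Cut-miss₀ a w ne = μL-miss w ne 0 , λ i → μL-miss w ne (suc i)

  cut-end : ∀ a (w : Word) j → ∃ λ n → j ≤ n × Cut a w n j
  cut-end a w j with w 0 ≟ a
  cut-end a w zero | yes p = 0 , z≤n , Cut-hit₀ a w p
  cut-end a w zero | no p  = 1 , z≤n , Cut-miss₀ a w p
  cut-end a w (suc j) | yes p =
    let n , j≤n , c = cut-end a (tail w) j in suc n , s≤s j≤n , Cut-hit a w p c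
  cut-end a w (suc j) | no p  =
    let n , j≤n , c = cut-end a (tail w) j in suc (suc n) , s≤s (m≤n⇒m≤1+n j≤n) , Cut-miss a w p c

  -- The letter `a` occurs in L_a(w) only as the first letter of a block, so the preceding block
  -- ends at `n`. The bounds hold because the blocks up to that of `w j` have one or two letters
  -- each, and the first has two when `w 0 ≢ a`.
  cut-before : ∀ a (w : Word) n → μω (L a) w (suc n) ≡ a →
    ∃ λ j → n ≤ suc (j * 2) × j ≤ n × (w 0 ≢ a → j < n) × Cut a w n j
  cut-before a w n eq with w 0 ≟ a
  cut-before a w zero eq | yes p = 0 , z≤n , z≤n , contradiction p , Cut-hit₀ a w p
  cut-before a w zero eq | no p  = contradiction (trans (sym (μL-miss w p 0)) eq) p
  cut-before a w (suc n) eq | yes p =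
    let j , lo , hi , _ , c = cut-before a (tail w) n (trans (sym (μL-hit w p (suc n))) eq)
    in suc j , s≤s (m≤n⇒m≤1+n lo) , s≤s hi , contradiction p , Cut-hit a w p c
  cut-before a w (suc zero) eq | no p = 0 , s≤s z≤n , z≤n , (λ _ → s≤s z≤n) , Cut-miss₀ a w p
  cut-before a w (suc (suc n)) eq | no p =
    let j , lo , hi , _ , c = cut-before a (tail w) n (trans (sym (μL-miss w p (suc (suc n)))) eq)
    in suc j , s≤s (s≤s lo) , s≤s (m≤n⇒m≤1+n hi) , (λ _ → s≤s (s≤s hi)) , Cut-miss a w p c

  μL-separates : ∀ a (w : Word) i → μω (L a) w i ≡ a ⊎ μω (L a) w (suc i) ≡ a
  μL-separates a w zero = inj₁ (μL-zero a w)
  μL-separates a w (suc i) with w 0 ≟ a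
  μL-separates a w (suc i) | yes p with μL-separates a (tail w) i
  ... | inj₁ e = inj₁ (trans (μL-hit w p i) e)
  ... | inj₂ e = inj₂ (trans (μL-hit w p (suc i)) e)
  μL-separates a w (suc zero)    | no p = inj₂ (trans (μL-miss w p 1) (μL-zero a (tail w)))
  μL-separates a w (suc (suc i)) | no p with μL-separates a (tail w) i
  ... | inj₁ e = inj₁ (trans (μL-miss w p (suc i)) e)
  ... | inj₂ e = inj₂ (trans (μL-miss w p (suc (suc i))) e)

  letter : Spinned (Fin k) → Fin k
  letter (L a) = a
  letter (R a) = a

  μ-separates : ∀ x (w : Word) i → μω x w i ≡ letter x ⊎ μω x w (suc i) ≡ letter x
  μ-separates (L a) w i = μL-separates a w i
  μ-separates (R a) w i with μL-separates a w (suc i)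
  ... | inj₁ e = inj₁ (trans (μR≗tail-μL a w i) e)
  ... | inj₂ e = inj₂ (trans (μR≗tail-μL a w (suc i)) e)

  -- A letter other than `a` is the second letter of its block, which makes the inequality strict;
  -- the descent for all-R directive words relies on this.
  μL-preimage : ∀ {a c} (w : Word) n → μω (L a) w n ≡ c → c ≢ a → ∃ λ j → j < n × w j ≡ c
  μL-preimage {a} w zero eq ne = contradiction (trans (sym eq) (μL-zero a w)) ne
  μL-preimage {a} w (suc n) eq ne with w 0 ≟ a
  μL-preimage w (suc n) eq ne | yes p =
    let j , j<n , e = μL-preimage (tail w) n (trans (sym (μL-hit w p n)) eq) ne
    in suc j , s≤s j<n , e
  μL-preimage w (suc zero) eq ne | no p = 0 , s≤s z≤n , trans (sym (μL-miss w p 0)) eq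
  μL-preimage w (suc (suc n)) eq ne | no p =
    let j , j<n , e = μL-preimage (tail w) n (trans (sym (μL-miss w p (suc n))) eq) ne
    in suc j , s≤s (m≤n⇒m≤1+n j<n) , e

  μL-recurrent : ∀ a (w : Word) → Recurrent w → Recurrent (μω (L a) w)
  μL-recurrent a w rec = recurrent (μω (L a) w) λ l N →
    let j , N≤j , agr = prefixRecurrent w rec l (suc N) in go l N j N≤j agr
    where
    go : ∀ l N j → suc N ≤ j → Agree l (drop j w) w →
         ∃ λ n → N ≤ n × Agree l (drop n (μω (L a) w)) (μω (L a) w)
    go l N (suc j) (s≤s N≤j) agr =
      -- The image of the return of `w` at `suc j` begins right after the block of `w j`.
      let n , j≤n , _ , rest = cut-end a w j
      in suc n , m≤n⇒m≤1+n (≤-trans N≤j j≤n) ,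
         λ i i<l → trans (rest i) (μL-encode l (drop (suc j) w) w agr i (m≤n⇒m≤1+n i<l))

  μ-recurrent : ∀ x (w : Word) → Recurrent w → Recurrent (μω x w)
  μ-recurrent (L a) w rec = μL-recurrent a w rec
  μ-recurrent (R a) w rec =
    Recurrent-resp (λ i → sym (μR≗tail-μL a w i)) (Recurrent-tail (μω (L a) w) (μL-recurrent a w rec))

  -- What follows the chosen `c` starts with `a`, as L_a(w) does, so a block ends at that `c` and
  -- encodes `c` itself. Lengths and positions are doubled because blocks have up to two letters.
  μL-leftExtends⁻¹ : ∀ {a c} (w : Word) → LeftExtends c (μω (L a) w) → LeftExtends c w
  μL-leftExtends⁻¹ {a} w ext l N =
    let n , 2N≤n , eq , agr = ext (suc (l * 2)) (N * 2)
        j , n≤2j+1 , _ , _ , e , rest = cut-before a w n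
          (trans (cong (μω (L a) w ∘ suc) (sym (+-identityʳ n))) (trans (agr 0 (s≤s z≤n)) (μL-zero a w)))
    in j , ≤-pred (*-cancelʳ-< 2 N (suc j) (s≤s (≤-trans 2N≤n n≤2j+1))) , trans (sym e) eq ,
       μL-decode l (drop (suc j) w) w λ i i< → trans (sym (rest i)) (agr i i<)

  μ-constant : ∀ x (w : Word) {c} → (∀ i → μω x w i ≡ c) → letter x ≡ c × (∀ j → w j ≡ c)
  μ-constant x w {c} const = x≡c , constant x const x≡c
    where
    x≡c : letter x ≡ c
    x≡c with μ-separates x w 0
    ... | inj₁ e = trans (sym e) (const 0)
    ... | inj₂ e = trans (sym e) (const 1)

    constant : ∀ x → (∀ i → μω x w i ≡ c) → letter x ≡ c → ∀ j → w j ≡ c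
    constant (L a) const _ j =
      let n , _ , e , _ = cut-end a w j in trans (sym e) (const n)
    constant (R a) const a≡c j with cut-end a w j
    -- Position 0 of L_a(w) is missing from R_a(w), but the letter there is known to be `a`.
    ... | zero  , _ , e , _ = trans (sym e) (trans (μL-zero a w) a≡c)
    ... | suc n , _ , e , _ = trans (sym e) (trans (sym (μR≗tail-μL a w n)) (const n))

  μL-◃ : ∀ c a (w : Word) → ∃ λ y → c ◃ μω (L a) w ≗ μω y (c ◃ w)
  μL-◃ c a w with c ≟ a
  ... | no ne    = R a , λ i → sym (μR-miss (c ◃ w) ne i)
  ... | yes refl = L a , λ where
    zero    → sym (μL-zero a (a ◃ w))
    (suc i) → sym (μL-hit (a ◃ w) refl i)

  tail-μ : ∀ x (w : Word) → ∃₂ λ y w' → tail (μω x w) ≗ μω y w' × (w' ≗ tail w ⊎ w' ≗ w)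
  tail-μ (L a) w = R a , w , (λ i → sym (μR≗tail-μL a w i)) , inj₂ (λ _ → refl)
  tail-μ (R a) w with w 0 ≟ a
  ... | yes e = R a , tail w ,
    (λ i → trans (μR-hit w e (suc i)) (sym (μR≗tail-μL a (tail w) i))) , inj₁ (λ _ → refl)
  ... | no ne = L a , tail w , (λ i → μR-miss w ne (suc i)) , inj₁ (λ _ → refl)

  -- Directive words

  private
    DirectiveWord : Set
    DirectiveWord = ω-Word (Spinned (Fin k))

  spin : (x : Spinned (Fin k)) → IsL x ⊎ IsR x
  spin (L a) = inj₁ (a , refl)
  spin (R a) = inj₂ (a , refl)

  IsL⇒≡ : ∀ (x : Spinned (Fin k)) → IsL x → x ≡ L (letter x)
  IsL⇒≡ x (a , refl) = refl

  IsL⇒¬IsR : ∀ {x : Spinned (Fin k)} → IsL x → ¬ IsR x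
  IsL⇒¬IsR (a , refl) (b , ())

  Directs-resp : ∀ (Δ : DirectiveWord) {v w : Word} → v ≗ w → Directs Δ v → Directs Δ w
  Directs-resp Δ v≗w (s , s₀ , rec , eq) = s , (λ i → trans (s₀ i) (v≗w i)) , rec , eq

  Directs-recurrent : ∀ (Δ : DirectiveWord) (t : Word) → Directs Δ t → Recurrent t
  Directs-recurrent Δ t (s , s₀ , rec , _) = Recurrent-resp s₀ (rec 0)

  uncons : ∀ (Δ : DirectiveWord) (t : Word) → Directs Δ t →
    ∃ λ t' → t ≗ μω (Δ 0) t' × Directs (tail Δ) t'
  uncons Δ t (s , s₀ , rec , eq) =
    s 1 , (λ i → trans (sym (s₀ i)) (eq 0 i)) , (s ∘ suc , (λ _ → refl) , rec ∘ suc , eq ∘ suc)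

  unconsAs : ∀ (Δ : DirectiveWord) {x} (t : Word) → Δ 0 ≡ x → Directs Δ t →
    ∃ λ t' → t ≗ μω x t' × Directs (tail Δ) t'
  unconsAs Δ t refl d = uncons Δ t d

  cons : ∀ (Δ : DirectiveWord) x t (t' : Word) → t ≗ μω x t' → Directs Δ t' → Directs (x ◃ Δ) t
  cons Δ x t t' t≗ d@(s , s₀ , rec , eq) = t ◃ s , (λ _ → refl) ,
    (λ where
       zero    → Recurrent-resp (λ i → sym (t≗ i)) (μ-recurrent x t' (Directs-recurrent Δ t' d))
       (suc n) → rec n) ,
    λ where
       zero    i → trans (t≗ i) (μ-cong x (λ j → sym (s₀ j)) i)
       (suc n) i → eq n i

  -- Coinduction: iterating `step` from `t` yields the directive word and the sequence of
  -- desubstituted words together.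
  Directs-coind : (S : Word → Set) → (∀ t → S t → Recurrent t) →
    (∀ t → S t → ∃₂ λ x t' → t ≗ μω x t' × S t') →
    ∀ t → S t → ∃ λ Δ → Directs Δ t
  Directs-coind S rec step t p =
    (λ n → let t' , q = state n in proj₁ (step t' q)) , proj₁ ∘ state , (λ _ → refl) ,
    (λ n → let t' , q = state n in rec t' q) ,
    (λ n → let t' , q = state n ; _ , _ , e , _ = step t' q in e)
    where
    state : ℕ → ∃ S
    state zero    = t , p
    state (suc n) = let t' , q = state n ; _ , t'' , _ , r = step t' q in t'' , r

  -- By `tail-μ`, deleting the first letter is absorbed at an L-spinned letter, which turns into an
  -- R, and is passed down one level at an R-spinned one. The two alternatives in `S` say whether
  -- the deletion is still pending.
  tail-directed : ∀ (Δ : DirectiveWord) (t : Word) → Directs Δ t → ∃ λ Δ' → Directs Δ' (tail t)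
  tail-directed Δ t d = Directs-coind S S-recurrent step (tail t) (Δ , t , d , inj₁ (λ _ → refl))
    where
    S : Word → Set
    S v = ∃₂ λ (Δ : DirectiveWord) w → Directs Δ w × (v ≗ tail w ⊎ v ≗ w)

    S-recurrent : ∀ v → S v → Recurrent v
    S-recurrent v (Δ , w , d , inj₁ e) =
      Recurrent-resp (λ i → sym (e i)) (Recurrent-tail w (Directs-recurrent Δ w d))
    S-recurrent v (Δ , w , d , inj₂ e) =
      Recurrent-resp (λ i → sym (e i)) (Directs-recurrent Δ w d)

    step : ∀ v → S v → ∃₂ λ x v' → v ≗ μω x v' × S v'
    step v (Δ , w , d , inj₁ e) =
      let w' , e' , d' = uncons Δ w d
          y , v' , e'' , alt = tail-μ (Δ 0) w'
      in y , v' , (λ i → trans (e i) (trans (e' (suc i)) (e'' i))) , tail Δ , w' , d' , alt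
    step v (Δ , w , d , inj₂ e) =
      let w' , e' , d' = uncons Δ w d
      in Δ 0 , w' , (λ i → trans (e i) (e' i)) , tail Δ , w' , d' , inj₂ (λ _ → refl)

  -- R_z preserves the first letter, and L_a puts `a` in front.
  head-after-Rs : ∀ {a} u (Δ : DirectiveWord) (t : Word) →
    OccursAt (map R u ++ [ L a ]) Δ 0 → Directs Δ t → t 0 ≡ a
  head-after-Rs {a} [] Δ t occ d =
    let t' , e , _ = unconsAs Δ t (∷-injectiveˡ occ) d in trans (e 0) (μL-zero a t')
  head-after-Rs (z ∷ u) Δ t occ d =
    let t' , e , d' = unconsAs Δ t (∷-injectiveˡ occ) d
    in trans (e 0) (trans (μR-zero z t') (head-after-Rs u (tail Δ) t' (∷-injectiveʳ occ) d'))

  -- The prepended `a` moves down through the L-spinned letters by `μL-◃`, changing spins where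
  -- needed, until R_a takes it up and becomes L_a.
  ◃-directed : ∀ {a} u (Δ : DirectiveWord) (t : Word) →
    OccursAt (map L u ++ [ R a ]) Δ 0 → Directs Δ t → ∃ λ Δ' → Directs Δ' (a ◃ t)
  ◃-directed {a} [] Δ t occ d =
    let t' , e , d' = unconsAs Δ t (∷-injectiveˡ occ) d
    in L a ◃ tail Δ , cons (tail Δ) (L a) (a ◃ t) t' (λ where
         zero    → sym (μL-zero a t')
         (suc i) → trans (e i) (μR≗tail-μL a t' i)) d'
  ◃-directed {a} (z ∷ u) Δ t occ d =
    let t' , e , d' = unconsAs Δ t (∷-injectiveˡ occ) d
        Δ' , d'' = ◃-directed u (tail Δ) t' (∷-injectiveʳ occ) d'
        y , e' = μL-◃ a z t'
    in y ◃ Δ' , cons Δ' y (a ◃ t) (a ◃ t') (λ where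
         zero    → e' 0
         (suc i) → trans (e i) (e' (suc i))) d''

  -- Uniqueness of the directive word implies the four conditions

  UniquelyDirects : DirectiveWord → Word → Set
  UniquelyDirects Δ t = Directs Δ t × (∀ Δ' → Directs Δ' t → Δ ≗ Δ')

  UniquelyDirects-uncons : ∀ (Δ : DirectiveWord) (t : Word) → UniquelyDirects Δ t →
    ∃ λ t' → t ≗ μω (Δ 0) t' × UniquelyDirects (tail Δ) t'
  UniquelyDirects-uncons Δ t (d , uniq) =
    let t' , e , d' = uncons Δ t d
    in t' , e , d' , λ Δ' d'' n → uniq (Δ 0 ◃ Δ') (cons Δ' (Δ 0) t t' e d'') (suc n)

  UniquelyDirects-drop : ∀ n (Δ : DirectiveWord) (t : Word) → UniquelyDirects Δ t →
    ∃ λ t' → UniquelyDirects (drop n Δ) t'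
  UniquelyDirects-drop zero    Δ t u = t , u
  UniquelyDirects-drop (suc n) Δ t u =
    let t' , _ , u' = UniquelyDirects-uncons Δ t u in UniquelyDirects-drop n (tail Δ) t' u'

  -- R_a(a w) = L_a(w): a head R a may become L a whenever the word starts with a.
  unique⇒head≢ : ∀ (Δ : DirectiveWord) {a} (t : Word) → UniquelyDirects Δ t → Δ 0 ≡ R a → t 0 ≢ a
  unique⇒head≢ Δ {a} t (d , uniq) eq t₀≡a =
    let t' , e , d' = unconsAs Δ t eq d
        Δ' , d'' = tail-directed (tail Δ) t' d'
        t'₀≡a = trans (sym (μR-zero a t')) (trans (sym (e 0)) t₀≡a)
    in L≢R (trans (sym (uniq (L a ◃ Δ')
         (cons Δ' (L a) t (tail t') (λ i → trans (e i) (μR-hit t' t'₀≡a i)) d'') 0)) eq)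
    where
    L≢R : L a ≢ R a
    L≢R ()

  -- The opposite exchange: L_a(t') = R_a(a t') would let the head `L a` become `R a`.
  unique⇒¬◃-directed : ∀ (Δ Δ' : DirectiveWord) {a} (t t' : Word) → UniquelyDirects Δ t →
    Δ 0 ≡ L a → t ≗ μω (L a) t' → ¬ Directs Δ' (a ◃ t')
  unique⇒¬◃-directed Δ Δ' {a} t t' (d , uniq) eq e d' =
    R≢L (trans (sym (uniq (R a ◃ Δ')
      (cons Δ' (R a) t (a ◃ t') (λ i → trans (e i) (sym (μR-hit (a ◃ t') refl i))) d') 0)) eq)
    where
    R≢L : R a ≢ L a
    R≢L ()

  unique⇒NoR⋯L : ∀ (Δ : DirectiveWord) (t : Word) → UniquelyDirects Δ t → NoR⋯L Δ
  unique⇒NoR⋯L Δ t U a u (i , occ) =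
    let t' , U' = UniquelyDirects-drop i Δ t U
    in unique⇒head≢ (drop i Δ) t' U' (∷-injectiveˡ occ)
         (head-after-Rs (a ∷ u) (drop i Δ) t' occ (proj₁ U'))

  unique⇒NoL⋯R : ∀ (Δ : DirectiveWord) (t : Word) → UniquelyDirects Δ t → NoL⋯R Δ
  unique⇒NoL⋯R Δ t U a u (i , occ) =
    let t' , U' = UniquelyDirects-drop i Δ t U
        t'' , e , d = unconsAs (drop i Δ) t' (∷-injectiveˡ occ) (proj₁ U')
        Δ' , d' = ◃-directed u (tail (drop i Δ)) t'' (∷-injectiveʳ occ) d
    in unique⇒¬◃-directed (drop i Δ) Δ' t' t'' U' (∷-injectiveˡ occ) e d'

  -- If all spins are R, the head of t never is the letter of the directive word, so the
  -- distance between its first two occurrences strictly decreases under desubstitution.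
  unique-allR⇒head-once : ∀ p (Δ : DirectiveWord) (t : Word) → UniquelyDirects Δ t →
    (∀ n → IsR (Δ n)) → ∀ j → j < p → t (suc j) ≢ t 0
  unique-allR⇒head-once (suc p) Δ t U allR j (s≤s j≤p) eq =
    let x , Δ₀≡ = allR 0
        t' , e , U' = UniquelyDirects-uncons Δ t U
        e' = subst (λ y → t ≗ μω y t') Δ₀≡ e
        t₀≡ = trans (e' 0) (μR-zero x t')
        t₀≢x = unique⇒head≢ Δ t U Δ₀≡
        tj≡ = trans (e' (suc j)) (μR-miss t' (t₀≢x ∘ trans t₀≡) (suc j))
        i , i<j , ti≡ = μL-preimage (tail t') j (trans (sym tj≡) eq) t₀≢x
    in unique-allR⇒head-once p (tail Δ) t' U' (allR ∘ suc) i (<-≤-trans i<j j≤p) (trans ti≡ t₀≡)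

  unique⇒¬allR : ∀ (Δ : DirectiveWord) (t : Word) → UniquelyDirects Δ t → ¬ (∀ n → IsR (Δ n))
  -- Recurrence supplies a second occurrence of the head, at a positive position.
  unique⇒¬allR Δ t U allR with prefixRecurrent t (Directs-recurrent Δ t (proj₁ U)) 1 1
  ... | suc j , _ , agr = unique-allR⇒head-once (suc j) Δ t U allR j ≤-refl
    (trans (cong (t ∘ suc) (sym (+-identityʳ j))) (agr 0 (s≤s z≤n)))

  -- Directive words with only L-spinned letters

  InfinitelyOftenLetter : Fin k → DirectiveWord → Set
  InfinitelyOftenLetter c Δ = InfinitelyOften (λ x → letter x ≡ c) Δ

  InfinitelyOften-tail : ∀ {A : Set} (P : A → Set) (w : ω-Word A) →
    InfinitelyOften P w → InfinitelyOften P (tail w)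
  InfinitelyOften-tail P w inf N with inf (suc N)
  ... | suc n , s≤s N≤n , p = n , N≤n , p

  InfinitelyOften-drop : ∀ {A : Set} (P : A → Set) m (w : ω-Word A) →
    InfinitelyOften P w → InfinitelyOften P (drop m w)
  InfinitelyOften-drop P zero    w inf = inf
  InfinitelyOften-drop P (suc m) w inf = InfinitelyOften-drop P m (tail w) (InfinitelyOften-tail P w inf)

  allL-contains : ∀ n (Δ : DirectiveWord) (t : Word) → Directs Δ t → (∀ n → IsL (Δ n)) →
    ∃ λ j → t j ≡ letter (Δ n)
  allL-contains zero Δ t d allL =
    let t' , e , _ = unconsAs Δ t (IsL⇒≡ (Δ 0) (allL 0)) d in 0 , trans (e 0) (μL-zero (letter (Δ 0)) t')
  allL-contains (suc n) Δ t d allL =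
    let t' , e , d' = unconsAs Δ t (IsL⇒≡ (Δ 0) (allL 0)) d
        j , eq = allL-contains n (tail Δ) t' d' (allL ∘ suc)
        i , _ , eq' , _ = cut-end (letter (Δ 0)) t' j
    in i , trans (e i) (trans eq' eq)

  -- Induction on the length of agreement: each L gains one letter by `μL-encode` and keeps `c` at
  -- the end of its block. At length 0 it suffices that `c` occurs in `t`, since `t` is recurrent.
  allL⇒leftExtends : ∀ {c} l (Δ : DirectiveWord) (t : Word) → Directs Δ t → (∀ n → IsL (Δ n)) →
    InfinitelyOftenLetter c Δ →
    ∀ N → ∃ λ j → N ≤ j × t j ≡ c × Agree l (drop (suc j) t) t
  allL⇒leftExtends zero Δ t d allL inf N =
    let n , _ , eq = inf 0
        i , eq' = allL-contains n Δ t d allL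
        j , N≤j , agr = prefixRecurrent t (Directs-recurrent Δ t d) (suc i) N
    in j + i , ≤-trans N≤j (m≤m+n j i) , trans (agr i ≤-refl) (trans eq' eq) , λ _ ()
  allL⇒leftExtends {c} (suc l) Δ t d allL inf N =
    let a = letter (Δ 0)
        t' , e , d' = unconsAs Δ t (IsL⇒≡ (Δ 0) (allL 0)) d
        j , N≤j , eq , agr = allL⇒leftExtends l (tail Δ) t' d' (allL ∘ suc)
          (InfinitelyOften-tail (λ x → letter x ≡ c) Δ inf) N
        n , j≤n , eq' , rest = cut-end a t' j
    in n , ≤-trans N≤j j≤n , trans (e n) (trans eq' eq) , λ i i<l →
       trans (e (suc n + i)) (trans (rest i)
         (trans (μL-encode l (drop (suc j) t') t' agr i i<l) (sym (e i))))

  -- The prepended `c` moves down forever by `μL-◃`, and left extendability keeps every word on the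
  -- way recurrent.
  allL⇒◃-directed : ∀ {c} (Δ : DirectiveWord) (t : Word) → Directs Δ t → (∀ n → IsL (Δ n)) →
    InfinitelyOftenLetter c Δ → ∃ λ Δ' → Directs Δ' (c ◃ t)
  allL⇒◃-directed {c} Δ t d allL inf =
    Directs-coind S S-recurrent step (c ◃ t) (Δ , t , (λ _ → refl) , d , allL , inf)
    where
    S : Word → Set
    S v = ∃₂ λ (Δ : DirectiveWord) w →
      v ≗ c ◃ w × Directs Δ w × (∀ n → IsL (Δ n)) × InfinitelyOftenLetter c Δ

    S-recurrent : ∀ v → S v → Recurrent v
    S-recurrent v (Δ , w , e , d , allL , inf) = Recurrent-resp (λ i → sym (e i))
      (leftExtends-recurrent c w (λ l → allL⇒leftExtends l Δ w d allL inf))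

    step : ∀ v → S v → ∃₂ λ x v' → v ≗ μω x v' × S v'
    step v (Δ , w , e , d , allL , inf) =
      let w' , e' , d' = unconsAs Δ w (IsL⇒≡ (Δ 0) (allL 0)) d
          y , e'' = μL-◃ c (letter (Δ 0)) w'
      in y , c ◃ w' ,
         (λ where
            zero    → trans (e 0) (e'' 0)
            (suc i) → trans (e (suc i)) (trans (e' i) (e'' (suc i)))) ,
         tail Δ , w' , (λ _ → refl) , d' , allL ∘ suc , InfinitelyOften-tail (λ x → letter x ≡ c) Δ inf

  -- The four conditions imply aperiodicity and uniqueness

  Balanced : DirectiveWord → Set
  Balanced Δ = InfinitelyOften IsL Δ × InfinitelyOften IsR Δ × NoR⋯L Δ × NoL⋯R Δ

  Balanced-tail : ∀ (Δ : DirectiveWord) → Balanced Δ → Balanced (tail Δ)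
  Balanced-tail Δ (infL , infR , noRL , noLR) =
    InfinitelyOften-tail IsL Δ infL , InfinitelyOften-tail IsR Δ infR ,
    (λ a u (i , occ) → noRL a u (suc i , occ)) , (λ a u (i , occ) → noLR a u (suc i , occ))

  adjacent-LR : ∀ (Δ : DirectiveWord) d m → IsL (Δ m) → IsR (Δ (d + m)) →
    ∃ λ n → IsL (Δ n) × IsR (Δ (suc n))
  adjacent-LR Δ zero    m l r = contradiction r (IsL⇒¬IsR l)
  adjacent-LR Δ (suc d) m l r with spin (Δ (suc m))
  ... | inj₂ r' = m , l , r'
  ... | inj₁ l' = adjacent-LR Δ d (suc m) l' (subst (λ n → IsR (Δ n)) (sym (+-suc d m)) r)

  -- Somewhere an L is directly followed by an R; with equal letters this would be a forbidden
  -- factor with empty middle.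
  balanced⇒letters-vary : ∀ (Δ : DirectiveWord) {c} → Balanced Δ → ¬ (∀ n → letter (Δ n) ≡ c)
  balanced⇒letters-vary Δ {c} (infL , infR , _ , noLR) const =
    let m , _ , l = infL 0
        n , m≤n , r = infR m
        i , (a , l') , (b , r') = adjacent-LR Δ (n ∸ m) m l
          (subst (λ n → IsR (Δ n)) (sym (m∸n+n≡m m≤n)) r)
        a≡c = trans (sym (cong letter l')) (const i)
        b≡c = trans (sym (cong letter r')) (const (suc i))
    in noLR c [] (i , cong₂ (λ x y → x ∷ y ∷ [])
         (trans (cong Δ (+-identityʳ i)) (trans l' (cong L a≡c)))
         (trans (cong Δ (+-comm i 1)) (trans r' (cong R b≡c))))

  constant⇒letters-constant : ∀ n (Δ : DirectiveWord) (t : Word) {c} → Directs Δ t →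
    (∀ i → t i ≡ c) → letter (Δ n) ≡ c
  constant⇒letters-constant n Δ t d const with uncons Δ t d
  ... | t' , e , d' with μ-constant (Δ 0) t' (λ i → trans (sym (e i)) (const i))
  constant⇒letters-constant zero    Δ t d const | t' , e , d' | x≡c , const' = x≡c
  constant⇒letters-constant (suc n) Δ t d const | t' , e , d' | x≡c , const' =
    constant⇒letters-constant n (tail Δ) t' d' const'

  EventuallyPeriodic : ℕ → Word → Set
  EventuallyPeriodic p w = ∃ λ N → ∀ i → N ≤ i → w (p + i) ≡ w i

  μ-eventuallyPeriodic⇒μL : ∀ x (w : Word) p → EventuallyPeriodic p (μω x w) →
    EventuallyPeriodic p (μω (L (letter x)) w)
  μ-eventuallyPeriodic⇒μL (L a) w p per = per
  μ-eventuallyPeriodic⇒μL (R a) w p (N , per) = suc N , λ where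
    (suc i) (s≤s N≤i) → trans (cong (μω (L a) w) (+-suc p i))
      (trans (sym (μR≗tail-μL a w (p + i))) (trans (per i N≤i) (μR≗tail-μL a w i)))

  -- A period of L_a(w) covers whole blocks, and one of them has length 2 when w has a
  -- letter other than a, so desubstitution shortens the period.
  μL-period-decreases : ∀ a (w : Word) p → (∀ N → ∃ λ j → N ≤ j × w j ≢ a) →
    EventuallyPeriodic (suc p) (μω (L a) w) → ∃ λ q → q < p × EventuallyPeriodic (suc q) w
  -- The suffix `v` is cut at a letter other than `a` past the onset of the period: its image is
  -- purely periodic and its first block has two letters.
  μL-period-decreases a w p misses (N , per) with misses (suc N)
  ... | suc j , s≤s N≤j , wj≢a with cut-end a w j
  ... | n , j≤n , _ , rest = periodic (cut-before a v p
      (trans (cong (μω (L a) v) (sym (+-identityʳ (suc p)))) (trans (purely 0) (μL-zero a v))))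
    where
    v : Word
    v = drop (suc j) w

    purely : ∀ i → μω (L a) v (suc p + i) ≡ μω (L a) v i
    purely i = trans (sym (rest (suc p + i)))
      (trans (cong (μω (L a) w) (+-exchange (suc n) (suc p) i))
        (trans (per (suc n + i) (≤-trans N≤j (≤-trans j≤n (m≤n⇒m≤1+n (m≤m+n n i))))) (rest i)))

    periodic : (∃ λ q → p ≤ suc (q * 2) × q ≤ p × (v 0 ≢ a → q < p) × Cut a v p q) →
      ∃ λ q → q < p × EventuallyPeriodic (suc q) w
    periodic (q , _ , _ , q<p , _ , rest') =
      q , q<p (wj≢a ∘ trans (cong w (sym (+-identityʳ (suc j))))) , suc j , λ i j<i →
        trans (cong w (shift i j<i)) (trans (sym (v≗ (i ∸ suc j))) (cong w (m+[n∸m]≡n j<i)))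
      where
      v≗ : v ≗ drop (suc q) v
      -- One period of the image consists of exactly the first `suc q` blocks, so `v` itself has
      -- period `suc q`.
      v≗ = μL-injective {a} λ i → trans (sym (purely i)) (rest' i)

      shift : ∀ i → suc j ≤ i → suc q + i ≡ suc j + (suc q + (i ∸ suc j))
      shift i j<i = trans (cong (suc q +_) (sym (m+[n∸m]≡n j<i)))
        (+-exchange (suc q) (suc j) (i ∸ suc j))

  -- The head of `t` survives desubstitution by R's down to the first L-spinned letter, whose letter
  -- it must be; `n` bounds the search for that letter.
  head-not-after-Rs : ∀ a n (Δ : DirectiveWord) (t : Word) → IsL (Δ n) →
    (∀ u → ¬ OccursAt (map R u ++ [ L a ]) Δ 0) → Directs Δ t → t 0 ≢ a
  head-not-after-Rs a n Δ t l avoid d t₀≡a with spin (Δ 0)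
  ... | inj₁ (z , eq) =
    let t' , e , _ = unconsAs Δ t eq d
        z≡a = trans (sym (μL-zero z t')) (trans (sym (e 0)) t₀≡a)
    in avoid [] (cong [_] (trans eq (cong L z≡a)))
  head-not-after-Rs a zero Δ t l avoid d t₀≡a | inj₂ r = contradiction r (IsL⇒¬IsR l)
  head-not-after-Rs a (suc n) Δ t l avoid d t₀≡a | inj₂ (z , eq) =
    let t' , e , d' = unconsAs Δ t eq d
    in head-not-after-Rs a n (tail Δ) t' l (λ u occ → avoid (z ∷ u) (cong₂ _∷_ eq occ)) d'
         (trans (sym (μR-zero z t')) (trans (sym (e 0)) t₀≡a))

  balanced⇒head≢ : ∀ (Δ : DirectiveWord) {a} (t : Word) → Balanced Δ → Directs Δ t →
    Δ 0 ≡ R a → t 0 ≢ a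
  balanced⇒head≢ Δ {a} t (infL , _ , noRL , _) d eq with infL 0
  ... | n , _ , l = head-not-after-Rs a n Δ t l avoid d
    where
    avoid : ∀ u → ¬ OccursAt (map R u ++ [ L a ]) Δ 0
    avoid []      occ with trans (sym eq) (∷-injectiveˡ occ)
    ... | ()
    avoid (z ∷ u) occ with trans (sym eq) (∷-injectiveˡ occ)
    ... | refl = noRL a u (0 , occ)

  -- At the first R-spinned letter R y one has y ≢ c, while the word does not start with y;
  -- hence prepending c creates a factor of length 2 that avoids the separating letter y.
  balanced⇒¬leftExtends : ∀ n c (Δ : DirectiveWord) (t : Word) → Balanced Δ → Directs Δ t →
    IsR (Δ n) → (∀ u → ¬ OccursAt (map L u ++ [ R c ]) Δ 0) → ¬ LeftExtends c t
  balanced⇒¬leftExtends n c Δ t bal d r avoid ext with spin (Δ 0)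
  ... | inj₂ (y , eq) =
    let t' , e , _ = unconsAs Δ t eq d
        -- An occurrence of `c` directly followed by the head of `t`.
        j , _ , tj≡c , agr = ext 1 0
        sj≡ = trans (cong (t ∘ suc) (sym (+-identityʳ j))) (agr 0 (s≤s z≤n))
    in absurd tj≡c sj≡ (e j) (e (suc j)) (μ-separates (R y) t' j)
    where
    absurd : ∀ {b b' s s'} → b ≡ c → s ≡ t 0 → b ≡ b' → s ≡ s' → ¬ (b' ≡ y ⊎ s' ≡ y)
    absurd b≡c _ b≡ _ (inj₁ b'≡y) =
      avoid [] (cong [_] (trans eq (cong R (trans (sym b'≡y) (trans (sym b≡) b≡c)))))
    absurd _ s≡ _ s≡s' (inj₂ s'≡y) =
      balanced⇒head≢ Δ t bal d eq (trans (sym s≡) (trans s≡s' s'≡y))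
  balanced⇒¬leftExtends zero c Δ t bal d r avoid ext | inj₁ l = contradiction r (IsL⇒¬IsR l)
  balanced⇒¬leftExtends (suc n) c Δ t bal d r avoid ext | inj₁ (z , eq) =
    let t' , e , d' = unconsAs Δ t eq d
    in balanced⇒¬leftExtends n c (tail Δ) t' (Balanced-tail Δ bal) d' r
         (λ u occ → avoid (z ∷ u) (cong₂ _∷_ eq occ))
         (μL-leftExtends⁻¹ t' (LeftExtends-resp e ext))

  -- If L_a(v) = R_a(w), then `w` starts with `a` and w = a v, so recurrence of `w` makes `a` a left
  -- extension of `v`.
  balanced-L⇒¬R : ∀ (Δ Δ' : DirectiveWord) {a} (t : Word) → Balanced Δ →
    Directs Δ t → Directs Δ' t → Δ 0 ≡ L a → Δ' 0 ≢ R a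
  balanced-L⇒¬R Δ Δ' {a} t bal@(_ , infR , _ , noLR) d d' eq eq' =
    let v , e , dv = unconsAs Δ t eq d
        w , e' , dw = unconsAs Δ' t eq' d'
        w₀≡a = trans (sym (μR-zero a w)) (trans (sym (e' 0)) (trans (e 0) (μL-zero a v)))
        tail-w≗v = μL-injective {a} λ i → trans (sym (μR-hit w w₀≡a i)) (trans (sym (e' i)) (e i))
        n , _ , r = InfinitelyOften-tail IsR Δ infR 0
    in balanced⇒¬leftExtends n a (tail Δ) v (Balanced-tail Δ bal) dv r
         (λ u occ → noLR a u (0 , cong₂ _∷_ eq occ))
         (LeftExtends-resp tail-w≗v (subst (λ b → LeftExtends b (tail w)) w₀≡a
           (recurrent-leftExtends w (Directs-recurrent (tail Δ') w dw))))

  two-separators⇒periodic : ∀ {a b} (t : Word) → a ≢ b →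
    (∀ i → t i ≡ a ⊎ t (suc i) ≡ a) → (∀ i → t i ≡ b ⊎ t (suc i) ≡ b) → ∀ i → t (2 + i) ≡ t i
  two-separators⇒periodic t a≢b sep-a sep-b i
    with sep-a i | sep-b i | sep-a (suc i) | sep-b (suc i)
  ... | inj₁ p | inj₁ q | _      | _      = contradiction (trans (sym p) q) a≢b
  ... | inj₂ p | inj₂ q | _      | _      = contradiction (trans (sym p) q) a≢b
  ... | inj₁ p | inj₂ q | inj₁ r | _      = contradiction (trans (sym r) q) a≢b
  ... | inj₁ p | inj₂ q | inj₂ r | _      = trans r (sym p)
  ... | inj₂ p | inj₁ q | _      | inj₁ r = contradiction (trans (sym p) r) a≢b
  ... | inj₂ p | inj₁ q | _      | inj₂ r = trans r (sym q)

  -- Classical arguments: aperiodicity, uniqueness and infinitely many letters of each spin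

  module _ (em : ExcludedMiddle 0ℓ) where

    infinitely-or-never : ∀ {A : Set} (P : A → Set) (w : ω-Word A) →
      InfinitelyOften P w ⊎ (∃ λ N → ∀ n → N ≤ n → ¬ P (w n))
    infinitely-or-never P w with em {∃ λ N → ∀ n → N ≤ n → ¬ P (w n)}
    ... | yes never = inj₂ never
    ... | no ¬never = inj₁ λ N → infinitely N em
      where
      infinitely : ∀ N → Dec (∃ λ n → N ≤ n × P (w n)) → ∃ λ n → N ≤ n × P (w n)
      infinitely N (yes p) = p
      infinitely N (no ¬p) = contradiction (N , λ n N≤n Pn → ¬p (n , N≤n , Pn)) ¬never

    -- If only `a` occurred from some point on, every prefix would return inside that region and `t`
    -- would be constant.
    nonconstant⇒misses : ∀ (t : Word) a → Recurrent t → ¬ (∀ i → t i ≡ a) →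
      ∀ N → ∃ λ j → N ≤ j × t j ≢ a
    nonconstant⇒misses t a rec ¬const with infinitely-or-never (_≢ a) t
    ... | inj₁ inf         = inf
    ... | inj₂ (M , never) = contradiction constant ¬const
      where
      constant : ∀ i → t i ≡ a
      constant i with prefixRecurrent t rec (suc i) M
      ... | j , M≤j , agr = trans (sym (agr i ≤-refl))
        (decidable-stable (t (j + i) ≟ a) (never (j + i) (≤-trans M≤j (m≤m+n j i))))

    -- Infinite descent on the period, with `m` as a bound. A constant `t'` would force all letters
    -- of `tail Δ` to be equal, so `t'` keeps producing blocks of length 2.
    balanced⇒¬eventuallyPeriodic : ∀ m p → p < m → ∀ (Δ : DirectiveWord) (t : Word) →
      Balanced Δ → Directs Δ t → ¬ EventuallyPeriodic (suc p) t
    balanced⇒¬eventuallyPeriodic (suc m) p (s≤s p≤m) Δ t bal d (N , per) =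
      let t' , e , d' = uncons Δ t d
          bal' = Balanced-tail Δ bal
          misses = nonconstant⇒misses t' (letter (Δ 0)) (Directs-recurrent (tail Δ) t' d')
            λ const → balanced⇒letters-vary (tail Δ) bal'
              λ n → constant⇒letters-constant n (tail Δ) t' d' const
          q , q<p , per' = μL-period-decreases (letter (Δ 0)) t' p misses
            (μ-eventuallyPeriodic⇒μL (Δ 0) t' (suc p)
              (N , λ i N≤i → trans (sym (e (suc p + i))) (trans (per i N≤i) (e i))))
      in balanced⇒¬eventuallyPeriodic m q (<-≤-trans q<p p≤m) (tail Δ) t' bal' d' per'

    balanced⇒head-unique : ∀ (Δ Δ' : DirectiveWord) (t : Word) → Balanced Δ →
      Directs Δ t → Directs Δ' t → Δ 0 ≡ Δ' 0
    balanced⇒head-unique Δ Δ' t bal d d' with letter (Δ 0) ≟ letter (Δ' 0)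
    ... | no ne = contradiction
      (0 , λ i _ → two-separators⇒periodic t ne (separates Δ d) (separates Δ' d') i)
      -- Period 2, written as `suc 1`.
      (balanced⇒¬eventuallyPeriodic 2 1 ≤-refl Δ t bal d)
      where
      separates : ∀ (Γ : DirectiveWord) → Directs Γ t →
        ∀ i → t i ≡ letter (Γ 0) ⊎ t (suc i) ≡ letter (Γ 0)
      separates Γ dΓ i with uncons Γ t dΓ
      ... | t' , e , _ with μ-separates (Γ 0) t' i
      ... | inj₁ q = inj₁ (trans (e i) q)
      ... | inj₂ q = inj₂ (trans (e (suc i)) q)
    ... | yes p with spin (Δ 0) | spin (Δ' 0)
    ...   | inj₁ (a , q) | inj₁ (b , r) =
      trans q (trans (cong L (trans (sym (cong letter q)) (trans p (cong letter r)))) (sym r))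
    ...   | inj₂ (a , q) | inj₂ (b , r) =
      trans q (trans (cong R (trans (sym (cong letter q)) (trans p (cong letter r)))) (sym r))
    ...   | inj₁ (a , q) | inj₂ (b , r) = contradiction
      (trans r (cong R (trans (sym (cong letter r)) (trans (sym p) (cong letter q)))))
      (balanced-L⇒¬R Δ Δ' t bal d d' q)
    -- Balance is known for `Δ` only, so the mixed cases are not symmetric. Here `Δ'` makes `t`
    -- start with the common letter, which a head R of `Δ` excludes.
    ...   | inj₂ (a , q) | inj₁ (b , r) with unconsAs Δ' t r d'
    ...   | t' , e , _ = contradiction
      (trans (e 0) (trans (μL-zero b t')
        (trans (sym (cong letter r)) (trans (sym p) (cong letter q)))))
      (balanced⇒head≢ Δ t bal d q)

    balanced⇒unique : ∀ n (Δ Δ' : DirectiveWord) (t : Word) → Balanced Δ →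
      Directs Δ t → Directs Δ' t → Δ n ≡ Δ' n
    balanced⇒unique zero    Δ Δ' t bal d d' = balanced⇒head-unique Δ Δ' t bal d d'
    balanced⇒unique (suc n) Δ Δ' t bal d d' =
      let v , e , dv = uncons Δ t d
          w , e' , dw = unconsAs Δ' t (sym (balanced⇒head-unique Δ Δ' t bal d d')) d'
          w≗v = μ-injective (Δ 0) λ i → trans (sym (e' i)) (e i)
      in balanced⇒unique n (tail Δ) (tail Δ') v (Balanced-tail Δ bal) dv
           (Directs-resp (tail Δ') w≗v dw)

    -- Pigeonhole: otherwise, beyond the largest of the finitely many last positions, no letter
    -- would be left for `Δ M`.
    some-letter-infinitely-often : ∀ (Δ : DirectiveWord) → ∃ λ c → InfinitelyOftenLetter c Δ
    some-letter-infinitely-often Δ with em {∃ λ c → InfinitelyOftenLetter c Δ}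
    ... | yes p = p
    ... | no ¬p = ⊥-elim (proj₂ (eventually-never c) M (bound c) refl)
      where
      eventually-never : ∀ c → ∃ λ N → ∀ n → N ≤ n → letter (Δ n) ≢ c
      eventually-never c with infinitely-or-never (λ x → letter x ≡ c) Δ
      ... | inj₁ inf   = contradiction (c , inf) ¬p
      ... | inj₂ never = never

      M : ℕ
      M = proj₁ (bounded (proj₁ ∘ eventually-never))

      bound : ∀ c → proj₁ (eventually-never c) ≤ M
      bound = proj₂ (bounded (proj₁ ∘ eventually-never))

      c : Fin k
      c = letter (Δ M)

    -- Take an occurrence of `L c` with `c` recurring forever: `c` can be prepended to the word
    -- below it, so that L could be exchanged for R.
    unique⇒¬allL : ∀ (Δ : DirectiveWord) (t : Word) → UniquelyDirects Δ t → ¬ (∀ n → IsL (Δ n))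
    unique⇒¬allL Δ t U allL =
      let c , inf = some-letter-infinitely-often Δ
          m , _ , eq = inf 0
          t' , U' = UniquelyDirects-drop m Δ t U
          Δₘ≡Lc = trans (cong Δ (+-identityʳ m)) (trans (IsL⇒≡ (Δ m) (allL m)) (cong L eq))
          t'' , e , d = unconsAs (drop m Δ) t' Δₘ≡Lc (proj₁ U')
          Δ' , d' = allL⇒◃-directed (tail (drop m Δ)) t'' d (λ n → allL (m + suc n))
            (InfinitelyOften-tail (λ x → letter x ≡ c) (drop m Δ)
              (InfinitelyOften-drop (λ x → letter x ≡ c) m Δ inf))
      in unique⇒¬◃-directed (drop m Δ) Δ' t' t'' U' Δₘ≡Lc e d'

    unique⇒balanced : ∀ (Δ : DirectiveWord) (t : Word) → UniquelyDirects Δ t → Balanced Δ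
    unique⇒balanced Δ t U = infinitelyL , infinitelyR , unique⇒NoR⋯L Δ t U , unique⇒NoL⋯R Δ t U
      where
      infinitelyL : InfinitelyOften IsL Δ
      infinitelyL with infinitely-or-never IsL Δ
      ... | inj₁ inf         = inf
      ... | inj₂ (N , never) = let t' , U' = UniquelyDirects-drop N Δ t U in
        ⊥-elim (unique⇒¬allR (drop N Δ) t' U' λ n →
          fromInj₂ (⊥-elim ∘ never (N + n) (m≤m+n N n)) (spin (Δ (N + n))))

      infinitelyR : InfinitelyOften IsR Δ
      infinitelyR with infinitely-or-never IsR Δ
      ... | inj₁ inf         = inf
      ... | inj₂ (N , never) = let t' , U' = UniquelyDirects-drop N Δ t U in
        ⊥-elim (unique⇒¬allL (drop N Δ) t' U' λ n →
          fromInj₁ (⊥-elim ∘ never (N + n) (m≤m+n N n)) (spin (Δ (N + n))))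

    balanced⇒aperiodic : ∀ (Δ : DirectiveWord) (t : Word) → Balanced Δ → Directs Δ t → Aperiodic t
    balanced⇒aperiodic Δ t bal d (u , v , e) =
      -- The period `length⁺ v` is the successor of the length of the tail, and it sets in after
      -- `u`.
      balanced⇒¬eventuallyPeriodic (length⁺ v) (length (List⁺.tail v)) ≤-refl Δ t bal d
        (length u , λ i |u|≤i → trans (e (length⁺ v + i)) (trans (period i |u|≤i) (sym (e i))))
      where
      period : ∀ i → length u ≤ i → (u · v ^ω) (length⁺ v + i) ≡ (u · v ^ω) i
      period i |u|≤i = begin
        (u · v ^ω) (length⁺ v + i)
          ≡⟨ cong (λ n → (u · v ^ω) (length⁺ v + n)) (m+[n∸m]≡n |u|≤i) ⟨
        (u · v ^ω) (length⁺ v + (length u + j))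
          ≡⟨ cong (u · v ^ω) (+-exchange (length⁺ v) (length u) j) ⟩
        (u · v ^ω) (length u + (length⁺ v + j))
          ≡⟨ drop-· u (v ^ω) (length⁺ v + j) ⟩
        (v ^ω) (length⁺ v + j)
          ≡⟨ drop-flatten (List⁺.head v) (List⁺.tail v) (λ _ → v) j ⟩
        (v ^ω) j
          ≡⟨ drop-· u (v ^ω) j ⟨
        (u · v ^ω) (length u + j)
          ≡⟨ cong (u · v ^ω) (m+[n∸m]≡n |u|≤i) ⟩
        (u · v ^ω) i
          ∎
        where
        open ≡-Reasoning
        j : ℕ
        j = i ∸ length u

theorem6p1 : ExcludedMiddle 0ℓ → (k : ℕ) (t : ω-Word (Fin k)) → Episturmian t →
    (∃! _≗_ (λ Δ → Directs Δ t) ⇔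
    (∃ λ Δ → Directs Δ t × Normalized Δ ×
    InfinitelyOften IsL Δ × InfinitelyOften IsR Δ × NoR⋯L Δ × NoL⋯R Δ))
    × (∃! _≗_ (λ Δ → Directs Δ t) → Aperiodic t)
theorem6p1 em k t _ = mk⇔
  (λ (Δ , d , uniq) →
    let bal@(infL , _ , noRL , _) = unique⇒balanced em Δ t (d , λ _ d' → uniq d')
    in Δ , d , (infL , noRL) , bal)
  (λ (Δ , d , _ , bal) → Δ , d , λ {Δ'} d' n → balanced⇒unique em n Δ Δ' t bal d d') ,
  λ (Δ , d , uniq) → balanced⇒aperiodic em Δ t (unique⇒balanced em Δ t (d , λ _ d' → uniq d')) d
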